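{- Let $G$ be a connected simple cubic graph of girth 4 and let $M(G)$ be a $\Pi$-map of $G$ in an orientable surface $S$ of genus $g(G)$. Then there is a one-to-one correspondence between the DETGCs $\mu'$ of $M(G)$ and the PFCs $\mu$ of $M(G)$, and likewise a one-to-one correspondence between the RETGCs $\mu'$ of $M(G)$ and the PFCs $\mu$ of $M(G)$ (here $\mu$ denotes the PFC associated with $\mu'$).
   Context: Write $[3]_0=\{0,1,2,3\}$. $G$ is a connected simple cubic graph of girth 4, and $g(G)$ is its genus. A set $S_0\subseteq V(G)$ is an efficient dominating set (EDS) if $|N_G[v]\cap S_0|=1$ for every $v\in V(G)$. A total coloring colors vertices and edges so that no two incident or adjacent elements get the same color. An efficient total coloring (ETC) of $G$ is a total coloring $\mu:V(G)\cup E(G)\to[3]_0$ such that for each vertex $v$ the restriction of $\mu$ to $N_G[v]$ is a bijection onto $[3]_0$, and the four vertex color classes partition $V(G)$ into EDSs. An ETGC is an ETC in which every 4-cycle of $G$ has each of the four colors exactly once on its vertices and exactly once on its edges. A map $M(G)$ is an embedding of $G$ in a connected closed orientable surface $S$ of genus $g(G)$ such that the components of $S\setminus G$ are open disks; closures of these disks are the faces, and a belt is a face boundary cycle (an $\ell$-belt if it has length $\ell$). A vertex of $G$ in no 4-cycle of $G$ is a Y-vertex; an edge with both ends Y-vertices is a Y-edge. A $2\ell$-belt with consecutive edges $(e_1,\dots,e_{2\ell})$ is a Y-belt if its Y-edges, if any, occur only in opposite pairs $\{e_h,e_{h+\ell}\}$, $1\le h\le\ell$. $M(G)$ is a Y-map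 if all belts have even length and are Y-belts. A $\Pi$-map is a Y-map $M(G)$ for which $V(G)$ admits a partition into four EDSs, labelled $0,1,2,3$, such that the cyclic sequence of vertex colors of each $\ell$-belt has the form $(a,b,c,d)^{\ell/4}$ with $\{a,b,c,d\}=[3]_0$. Given an ETGC of a $\Pi$-map, a belt is directed (resp. reversed) if each color-0 edge $e$ on it lies in the clockwise (resp. counterclockwise) direction from a color-0 vertex $v$ of the belt, with distance 1 from $v$ to the nearest end-vertex of $e$. (Clockwise is with respect to the orientation of the face.) An ETGC is a DETGC (resp. RETGC) if every belt is directed (resp. reversed). An ETGC is periodic if for each belt, traversed in one of its two directions, the alternating cyclic sequence of colors (vertex, edge, vertex, edge, ...) is a concatenation of copies of $a,b,c,a,d,c,b,d$ for some $\{a,b,c,d\}=[3]_0$ (odd positions vertex colors, even positions edge colors). Given a periodic ETGC $\mu'$ of a $\Pi$-map $M(G)$, its associated 3-permutation face coloring $\mu$ assigns to the face with belt $B$ the permutation $\mu(B)=abc$ of $\{1,2,3\}$, where $0,a,b,c$ are the $\mu'$-colors of four consecutive vertices of $B$ in clockwise order starting at a vertex of color $0$. A PFC of $M(G)$ is a face coloring by 3-permutations obtained in this way from a periodic ETGC of $M(G)$.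
   Formalization: DETGCs and RETGCs are additionally required to have vertex color classes that themselves read (a,b,c,d)^{ℓ/4} on every belt; without this a directed ETGC of a Π-map can be non-periodic and then has no associated PFC. -}

module Defs where

open import Data.Bool using (Bool; T; _∧_)
open import Data.Fin using (Fin; toℕ; _≟_)
open import Data.Fin.Patterns using (0F; 1F; 2F; 3F)
open import Data.Fin.Subset using (Subset; _∈_; _∩_; _∪_; ⁅_⁆; ∣_∣)
open import Data.List
  using (List; []; _∷_; map; concat; concatMap; reverse; replicate; iterate;
         length; filterᵇ; cartesianProduct; allFin)
import Data.List.Membership.Propositional as List
open import Data.List.Relation.Binary.Permutation.Propositional using (_↭_)
open import Data.Nat using (ℕ; suc; _+_; _*_; _≤_; _<_; _<ᵇ_)
open import Data.Nat.DivMod using (_mod_)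
open import Data.Nat.GeneralisedArithmetic using (fold)
open import Data.Product using (Σ; Σ-syntax; ∃; ∃-syntax; _×_; _,_; proj₁; proj₂)
open import Data.Sum using (_⊎_)
open import Data.Vec using (Vec; []; _∷_; tabulate; toList)
open import Function using (_∘_; _on_)
open import Function.Bundles using (_⇔_)
open import Function.Definitions using (Injective; Surjective; Bijective)
open import Level using (0ℓ)
open import Relation.Binary.Bundles using (Setoid)
open import Relation.Binary.Construct.Closure.ReflexiveTransitive using (Star)
import Relation.Binary.Construct.On as On
open import Relation.Binary.PropositionalEquality
  using (_≡_; _≢_; refl; sym; trans)
open import Relation.Nullary using (¬_; does)

------------------------------------------------------------------------
-- Finite simple graphs

record Graph : Set where
  field
    order       : ℕ
    adj         : Fin order → Fin order → Bool
    symmetric   : ∀ {u v} → T (adj u v) → T (adj v u)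
    irreflexive : ∀ {v} → ¬ T (adj v v)

  Vertex : Set
  Vertex = Fin order

  infix 4 _~_
  _~_ : Vertex → Vertex → Set
  u ~ v = T (adj u v)

  N⟨_⟩ : Vertex → Subset order
  N⟨ v ⟩ = tabulate (adj v)

  N[_] : Vertex → Subset order
  N[ v ] = ⁅ v ⁆ ∪ N⟨ v ⟩

  size : ℕ
  size = length (filterᵇ (λ (u , v) → (toℕ u <ᵇ toℕ v) ∧ adj u v)
                         (cartesianProduct (allFin order) (allFin order)))

  -- An edge taken with one of its two directions; an undirected edge is
  -- the pair of a dart and its reverse.
  record Dart : Set where
    eta-equality
    constructor dart
    field
      tail head : Vertex
      joined    : tail ~ head

  open Dart public

  rev : Dart → Dart
  rev (dart u v p) = dart v u (symmetric p)

Connected : Graph → Set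
Connected G = ∀ u v → Star _~_ u v
  where open Graph G

Cubic : Graph → Set
Cubic G = ∀ v → ∣ N⟨ v ⟩ ∣ ≡ 3
  where open Graph G

next : ∀ {k} → Fin k → Fin k
next {suc k} i = suc (toℕ i) mod suc k

record Cycle (G : Graph) (k : ℕ) : Set where
  open Graph G
  field
    3≤k      : 3 ≤ k
    vertex   : Fin k → Vertex
    distinct : Injective _≡_ _≡_ vertex
    adjacent : ∀ i → vertex i ~ vertex (next i)

  edge : Fin k → Dart
  edge i = dart (vertex i) (vertex (next i)) (adjacent i)

HasGirth : Graph → ℕ → Set
HasGirth G g = Cycle G g × (∀ k → Cycle G k → g ≤ k)

IsYVertex : (G : Graph) → Graph.Vertex G → Set
IsYVertex G v = ¬ (Σ[ C ∈ Cycle G 4 ] ∃[ i ] Cycle.vertex C i ≡ v)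

IsYEdge : (G : Graph) → Graph.Dart G → Set
IsYEdge G e = IsYVertex G (tail e) × IsYVertex G (head e)
  where open Graph G

-- S is an efficient dominating set.
IsEDS : (G : Graph) → Subset (Graph.order G) → Set
IsEDS G S = ∀ v → ∣ N[ v ] ∩ S ∣ ≡ 1
  where open Graph G

------------------------------------------------------------------------
-- Colors

Color : Set
Color = Fin 4

-- {a,b,c,d} = {0,1,2,3}
AllFour : Color → Color → Color → Color → Set
AllFour a b c d = ∀ k → k List.∈ (a ∷ b ∷ c ∷ d ∷ [])

_^^_ : List Color → ℕ → List Color
xs ^^ k = concat (replicate k xs)

colorClass : ∀ {n} → (Fin n → Color) → Color → Subset n
colorClass ν k = tabulate (λ v → does (ν v ≟ k))

IsEDSPartition : (G : Graph) → (Graph.Vertex G → Color) → Set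
IsEDSPartition G ν = ∀ k → IsEDS G (colorClass ν k)

record TotalColoring (G : Graph) : Set where
  open Graph G
  field
    vcol     : Vertex → Color
    ecol     : Dart → Color
    ecol-rev : ∀ e → ecol (rev e) ≡ ecol e
    proper-vv : ∀ {u v} → u ~ v → vcol u ≢ vcol v
    proper-ve : ∀ e → vcol (tail e) ≢ ecol e
    proper-ee : ∀ {e e′} → tail e ≡ tail e′ → head e ≢ head e′ → ecol e ≢ ecol e′

record IsETC (G : Graph) (μ : TotalColoring G) : Set where
  open Graph G
  open TotalColoring μ
  field
    closedNbhd-bijective :
      ∀ v → Bijective (_≡_ on proj₁) _≡_
                      (λ (u : Σ[ u ∈ Vertex ] u ∈ N[ v ]) → vcol (proj₁ u))
    edsPartition : IsEDSPartition G vcol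

record IsETGC (G : Graph) (μ : TotalColoring G) : Set where
  open TotalColoring μ
  field
    isETC          : IsETC G μ
    cycle-vertices : (C : Cycle G 4) → Bijective _≡_ _≡_ (vcol ∘ Cycle.vertex C)
    cycle-edges    : (C : Cycle G 4) → Bijective _≡_ _≡_ (ecol ∘ Cycle.edge C)

------------------------------------------------------------------------
-- Cellular embeddings in closed orientable surfaces

-- Such an embedding of a connected graph is given, up to
-- orientation-preserving homeomorphism, by a rotation system: `rot`
-- sends a dart to the next one counterclockwise around its tail.
-- Arriving along e and leaving along rot (rev e) keeps the face on the
-- right, so each orbit of φ is a face boundary traversed clockwise.
record Embedding (G : Graph) : Set where
  open Graph G
  field
    rot            : Dart → Dart
    rot-tail       : ∀ e → tail (rot e) ≡ tail e
    rot-injective  : Injective _≡_ _≡_ rot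
    rot-transitive : ∀ e e′ → tail e ≡ tail e′ → ∃[ k ] fold e rot k ≡ e′

  φ : Dart → Dart
  φ e = rot (rev e)

  -- `face e` is the face on the right of e.  These fields are determined
  -- by `rot`, up to the numbering of the faces.
  field
    faceCount       : ℕ
    face            : Dart → Fin faceCount
    face-surjective : Surjective _≡_ _≡_ face
    face-orbit      : ∀ e e′ → face e ≡ face e′ ⇔ (∃[ k ] fold e φ k ≡ e′)
    faceLength      : Fin faceCount → ℕ
    length-positive : ∀ f → 0 < faceLength f
    length-period   : ∀ e → fold e φ (faceLength (face e)) ≡ e
    length-minimal  : ∀ e k → 0 < k → fold e φ k ≡ e → faceLength (face e) ≤ k

  Face : Set
  Face = Fin faceCount

  -- The edges of a belt in clockwise (counterclockwise) order, each
  -- directed forwards, beginning (ending) at the given edge.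
  clockwise : Dart → List Dart
  clockwise e = iterate φ e (faceLength (face e))

  counterclockwise : Dart → List Dart
  counterclockwise e = map rev (reverse (clockwise e))

-- Euler's formula |V| - |E| + |F| = 2 - 2g, without subtraction.
EmbedsInGenus : {G : Graph} → Embedding G → ℕ → Set
EmbedsInGenus {G} M g =
  Graph.order G + Embedding.faceCount M + 2 * g ≡ Graph.size G + 2

HasGenus : Graph → ℕ → Set
HasGenus G g = (Σ[ M ∈ Embedding G ] EmbedsInGenus M g)
             × (∀ (M : Embedding G) h → EmbedsInGenus M h → g ≤ h)

module _ {G : Graph} (M : Embedding G) where
  open Graph G
  open Embedding M
  open TotalColoring

  IsMap : Set
  IsMap = ∃[ g ] HasGenus G g × EmbedsInGenus M g

  EvenYBelt : Face → Set
  EvenYBelt f = ∃[ ℓ ] faceLength f ≡ 2 * ℓ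
              × (∀ e → face e ≡ f → IsYEdge G e → IsYEdge G (fold e φ ℓ))

  record IsYMap : Set where
    field
      isMap : IsMap
      belts : ∀ f → EvenYBelt f

  record IsΠColoring (ν : Vertex → Color) : Set where
    field
      edsPartition : IsEDSPartition G ν
      belts : ∀ f → ∃[ e ] face e ≡ f
            × ∃[ a ] ∃[ b ] ∃[ c ] ∃[ d ] AllFour a b c d
            × ∃[ k ] map (ν ∘ tail) (clockwise e) ≡ (a ∷ b ∷ c ∷ d ∷ []) ^^ k

  record IsΠMap : Set where
    field
      isYMap    : IsYMap
      ΠColoring : ∃ IsΠColoring

  ----------------------------------------------------------------------
  -- Directed and reversed colorings

  -- An ETGC of a Π-map: its vertex color classes form a partition as in
  -- the definition of a Π-map.  For an arbitrary ETGC of the underlying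
  -- graph, directedness of all belts would not imply periodicity.
  record IsETGCOfΠMap (μ : TotalColoring G) : Set where
    field
      isETGC      : IsETGC G μ
      isΠColoring : IsΠColoring (vcol μ)

  -- Clockwise on the belt: v, w, e, where v = tail e₀ has color 0 and
  -- w = head e₀ is the end of e nearest to v.
  Directed : TotalColoring G → Face → Set
  Directed μ f = ∀ e → face e ≡ f → ecol μ e ≡ 0F →
                 ∃[ e₀ ] vcol μ (tail e₀) ≡ 0F × φ e₀ ≡ e

  -- Clockwise on the belt: e, w, v, where w = head e and v has color 0.
  Reversed : TotalColoring G → Face → Set
  Reversed μ f = ∀ e → face e ≡ f → ecol μ e ≡ 0F →
                 vcol μ (head (φ e)) ≡ 0F

  record DETGC : Set where
    field
      coloring     : TotalColoring G
      isETGCOfΠMap : IsETGCOfΠMap coloring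
      directed     : ∀ f → Directed coloring f

  record RETGC : Set where
    field
      coloring     : TotalColoring G
      isETGCOfΠMap : IsETGCOfΠMap coloring
      reversed     : ∀ f → Reversed coloring f

  ----------------------------------------------------------------------
  -- Periodic colorings and their face colorings

  alternating : TotalColoring G → List Dart → List Color
  alternating μ = concatMap (λ e → vcol μ (tail e) ∷ ecol μ e ∷ [])

  IsPeriodicSequence : List Color → Set
  IsPeriodicSequence xs =
    ∃[ a ] ∃[ b ] ∃[ c ] ∃[ d ] AllFour a b c d
    × ∃[ k ] xs ≡ (a ∷ b ∷ c ∷ a ∷ d ∷ c ∷ b ∷ d ∷ []) ^^ k

  record IsPeriodicETGC (μ : TotalColoring G) : Set where
    field
      isETGC   : IsETGC G μ
      periodic : ∀ f → ∃[ e ] face e ≡ f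
               × (IsPeriodicSequence (alternating μ (clockwise e))
                 ⊎ IsPeriodicSequence (alternating μ (counterclockwise e)))

  -- A permutation of {1,2,3} in one-line notation.
  record ThreePermutation : Set where
    field
      entries       : Vec Color 3
      isPermutation : toList entries ↭ (1F ∷ 2F ∷ 3F ∷ [])

  open ThreePermutation

  FaceColoring : Set
  FaceColoring = Face → ThreePermutation

  record IsAssociated (μ′ : TotalColoring G) (μ : FaceColoring) : Set where
    field
      isPeriodicETGC : IsPeriodicETGC μ′
      reading        : ∀ e → vcol μ′ (tail e) ≡ 0F →
        entries (μ (face e)) ≡ vcol μ′ (tail (φ e))
                             ∷ vcol μ′ (tail (φ (φ e)))
                             ∷ vcol μ′ (tail (φ (φ (φ e))))
                             ∷ []

  record PFC : Set where
    field
      faceColoring : FaceColoring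
      fromPeriodic : ∃[ μ′ ] IsAssociated μ′ faceColoring

  ----------------------------------------------------------------------
  -- Colorings are identified when they give every element the same color.

  totalColorings : Setoid 0ℓ 0ℓ
  totalColorings = record
    { Carrier = TotalColoring G
    ; _≈_ = λ μ₁ μ₂ → (∀ v → vcol μ₁ v ≡ vcol μ₂ v) × (∀ e → ecol μ₁ e ≡ ecol μ₂ e)
    ; isEquivalence = record
      { refl  = (λ _ → refl) , (λ _ → refl)
      ; sym   = λ (p , q) → (λ v → sym (p v)) , (λ e → sym (q e))
      ; trans = λ (p , q) (p′ , q′) →
                  (λ v → trans (p v) (p′ v)) , (λ e → trans (q e) (q′ e))
      }
    }

  faceColorings : Setoid 0ℓ 0ℓ
  faceColorings = record
    { Carrier = FaceColoring
    ; _≈_ = λ μ₁ μ₂ → ∀ f → entries (μ₁ f) ≡ entries (μ₂ f)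
    ; isEquivalence = record
      { refl  = λ _ → refl
      ; sym   = λ p f → sym (p f)
      ; trans = λ p q f → trans (p f) (q f)
      }
    }

  DETGCs : Setoid 0ℓ 0ℓ
  DETGCs = On.setoid totalColorings DETGC.coloring

  RETGCs : Setoid 0ℓ 0ℓ
  RETGCs = On.setoid totalColorings RETGC.coloring

  PFCs : Setoid 0ℓ 0ℓ
  PFCs = On.setoid faceColorings PFC.faceColoring

module Submission where

-- On every belt the vertex colors have period 4, with four different colors
-- in a row. So an edge of a total coloring, which avoids the colors of its two
-- ends, has on each belt either the color of the vertex before its tail or
-- that of the vertex after its head. Let a vertex of color x have neighbors of
-- colors p, q, r in the order of rotation; its belts then pass through it as
-- pxqr, qxrp and rxpq (`star`). The edge to p is therefore colored r when it
-- takes its color from the side before, and q from the side after, on both of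
-- its belts. Since the three edges at the vertex have different colors, all of
-- them use the same side (`taken-rot`).
--
-- If every edge of color 0 uses a given side, then every edge does
-- (`taken-everywhere`): at a vertex of color other than 0 some edge would be
-- colored 0 from the wrong side if the edges there used that side, and an edge
-- has at most one end of color 0. Thus DETGCs and RETGCs are exactly the
-- ETGCs, with vertex colors as in a Π-map, all of whose edges take their
-- colors from the side before, respectively after. Such a coloring is periodic
-- (`sided⇒periodic`), and its edge colors are determined by its vertex colors.
-- Conversely, the vertex colors of a periodic ETGC are four-periodic on belts
-- (`periodic⇒Π`), and coloring all edges from one side gives again an ETGC
-- (`recolor`); the condition on 4-cycles comes for free
-- (`cycle-edges-bijective`). This shows that every PFC is reached.
--
-- It remains to recover the vertex colors from the face permutations. The
-- permutations of the three faces at a vertex have the same parity exactly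
-- when the vertex has color 0; otherwise one of them is of the other parity,
-- and the color of the vertex is its middle entry (`centre-code`).

open import Defs
open import Data.Product using (Σ-syntax; _×_)
open import Function.Bundles using (Bijection)

open import Data.Bool using (Bool; true; false)
open import Data.Bool.Properties using (T-irrelevant; T-≡)
open import Data.Fin using (Fin; _≟_; punchOut)
open import Data.Fin.Patterns using (0F; 1F; 2F; 3F)
open import Data.Fin.Properties
  using (all?; any?; injective⇒≤; punchOut-injective; ≤-decTotalOrder)
import Data.Fin.Subset as Subset
open import Data.Fin.Subset.Properties
  using (x∈⁅y⁆⇒x≡y; x∈p∪q⁻; x∈p∪q⁺)
open import Data.List
  using (List; []; _∷_; _++_; [_]; length; lookup; map; concatMap; reverse; iterate)
open import Data.List.Membership.Propositional using (_∈_; _∉_)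
open import Data.List.Membership.DecPropositional (_≟_ {4}) using (_∈?_)
open import Data.List.Properties
  using (∷-injectiveˡ; ∷-injectiveʳ; ++-assoc; ++-identityʳ; length-map;
         length-iterate; map-∘; map-cong; concatMap-++; concatMap-map; reverse-++;
         reverse-map; reverse-involutive; unfold-reverse; ≡-dec)
open import Data.List.Relation.Binary.Permutation.Propositional using (_↭_; ↭-sym)
open import Data.List.Relation.Unary.Any using (here; there; index)
open import Data.List.Relation.Unary.Any.Properties using (lookup-index)
open import Data.List.Sort.InsertionSort.Base (≤-decTotalOrder 4) using (sort)
open import Data.List.Sort.InsertionSort.Properties (≤-decTotalOrder 4) using (sort-↭)
open import Data.Nat using (ℕ; zero; suc; _+_; _*_; _≤_; _<_)
open import Data.Nat.GeneralisedArithmetic using (fold; fold-+)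
open import Data.Nat.Properties using (+-comm; 1+n≰n; <-irrefl)
open import Data.Product using (∃; ∃-syntax; _,_; proj₁; proj₂)
open import Data.Sum using (_⊎_; inj₁; inj₂)
open import Data.Vec using (Vec; []; _∷_; toList; tabulate)
open import Data.Vec.Properties
  using (lookup∘tabulate; lookup⇒[]=; []=⇒lookup) renaming (≡-dec to ≡-decᵛ)
open import Function using (_∘_; _on_)
open import Function.Bundles using (Equivalence)
open import Function.Definitions using (Bijective; Injective; Surjective)
open import Relation.Binary.Bundles using (Setoid)
import Relation.Binary.Construct.On as On
open import Relation.Binary.PropositionalEquality
  using (_≡_; _≢_; refl; sym; trans; cong; cong₂; subst; module ≡-Reasoning)
open import Relation.Nullary using (Dec; yes; no; ¬_; contradiction)
open import Relation.Nullary.Decidable using (True; toWitness; _→-dec_)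

-- Four colors

-- Every color occurs in the list; AllFour a b c d is Covers (a ∷ b ∷ c ∷ d ∷ []).
Covers : List Color → Set
Covers xs = ∀ k → k ∈ xs

covers⇒4≤length : ∀ {xs} → Covers xs → 4 ≤ length xs
covers⇒4≤length {xs} all = injective⇒≤ {f = λ k → index (all k)} λ {i} {j} eq →
  trans (lookup-index (all i))
        (trans (cong (lookup xs) eq) (sym (lookup-index (all j))))

module _ {a b c d : Color} (all : AllFour a b c d) where

  allFour-rotate : AllFour b c d a
  allFour-rotate k with all k
  ... | here eq                         = there (there (there (here eq)))
  ... | there (here eq)                 = here eq
  ... | there (there (here eq))         = there (here eq)
  ... | there (there (there (here eq))) = there (there (here eq))

  first∉rest : a ∉ b ∷ c ∷ d ∷ []
  first∉rest a∈ = 1+n≰n (covers⇒4≤length rest)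
    where
    rest : Covers (b ∷ c ∷ d ∷ [])
    rest k with all k
    ... | here refl = a∈
    ... | there k∈  = k∈

  1st≢2nd : a ≢ b
  1st≢2nd = first∉rest ∘ here

  1st≢3rd : a ≢ c
  1st≢3rd = first∉rest ∘ there ∘ here

  1st≢4th : a ≢ d
  1st≢4th = first∉rest ∘ there ∘ there ∘ here

  third-or-fourth : ∀ {k} → k ≢ a → k ≢ b → k ≡ c ⊎ k ≡ d
  third-or-fourth {k} k≢a k≢b with all k
  ... | here eq                         = contradiction eq k≢a
  ... | there (here eq)                 = contradiction eq k≢b
  ... | there (there (here eq))         = inj₁ eq
  ... | there (there (there (here eq))) = inj₂ eq

  fourth : ∀ {k} → k ≢ a → k ≢ b → k ≢ c → k ≡ d
  fourth k≢a k≢b k≢c with third-or-fourth k≢a k≢b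
  ... | inj₁ k≡c = contradiction k≡c k≢c
  ... | inj₂ k≡d = k≡d

allFour? : ∀ a b c d → Dec (AllFour a b c d)
allFour? a b c d = all? λ k → k ∈? (a ∷ b ∷ c ∷ d ∷ [])

allFour-cong : ∀ {a b c d a′ b′ c′ d′} → a′ ≡ a → b′ ≡ b → c′ ≡ c → d′ ≡ d →
               AllFour a b c d → AllFour a′ b′ c′ d′
allFour-cong refl refl refl refl all = all

-- Verifies a decidable property on the 24 arrangements of the colors, by
-- evaluating it.
byCases : {P : Color → Color → Color → Color → Set}
          (P? : ∀ a b c d → Dec (P a b c d)) →
          let Q? = all? λ a → all? λ b → all? λ c → all? λ d →
                     allFour? a b c d →-dec P? a b c d in
          {True Q?} → ∀ {a b c d} → AllFour a b c d → P a b c d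
byCases P? {ok} {a} {b} {c} {d} = toWitness ok a b c d

-- The three colors that follow 0 in the cyclic word abcd. The last clause
-- presumes d = 0.
code : Color → Color → Color → Color → Vec Color 3
code 0F b  c  d = b ∷ c ∷ d ∷ []
code a  0F c  d = c ∷ d ∷ a ∷ []
code a  b  0F d = d ∷ a ∷ b ∷ []
code a  b  c  _ = a ∷ b ∷ c ∷ []

code-cong : ∀ {a b c d a′ b′ c′ d′} → a ≡ a′ → b ≡ b′ → c ≡ c′ → d ≡ d′ →
            code a b c d ≡ code a′ b′ c′ d′
code-cong refl refl refl refl = refl

vec? : (xs ys : Vec Color 3) → Dec (xs ≡ ys)
vec? = ≡-decᵛ _≟_

-- The code depends only on the cyclic word.
code-rotate : ∀ {a b c d} → AllFour a b c d → code b c d a ≡ code a b c d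
code-rotate = byCases λ a b c d → vec? (code b c d a) (code a b c d)

code-↭ : ∀ {a b c d} → AllFour a b c d →
         toList (code a b c d) ↭ 1F ∷ 2F ∷ 3F ∷ []
code-↭ {a} {b} {c} {d} all =
  ↭-sym (subst (_↭ toList (code a b c d)) (sorted all) (sort-↭ (toList (code a b c d))))
  where
  sorted : ∀ {a b c d} → AllFour a b c d →
           sort (toList (code a b c d)) ≡ 1F ∷ 2F ∷ 3F ∷ []
  sorted = byCases λ a b c d → ≡-dec _≟_ (sort (toList (code a b c d))) (1F ∷ 2F ∷ 3F ∷ [])

-- Whether a permutation of 1, 2, 3 is even, that is, one of 123, 231, 312.
isEven : Vec Color 3 → Bool
isEven (1F ∷ 2F ∷ _) = true
isEven (2F ∷ 3F ∷ _) = true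
isEven (3F ∷ 1F ∷ _) = true
isEven _             = false

middle : Vec Color 3 → Color
middle (_ ∷ b ∷ _) = b

-- The color of a vertex, from the codes of its three faces: 0 if they have the
-- same parity, otherwise the middle entry of the one whose parity differs.
centre : Vec Color 3 → Vec Color 3 → Vec Color 3 → Color
centre A B C with isEven A | isEven B | isEven C
... | true  | true  | true  = 0F
... | false | false | false = 0F
... | true  | false | false = middle A
... | false | true  | true  = middle A
... | false | true  | false = middle B
... | true  | false | true  = middle B
... | _     | _     | _     = middle C

-- For x = 0 the codes are rotations of one another. If, say, r = 0, they are
-- pxq, pqx and xpq, of which the last two are rotations of one another and the
-- first is not.
centre-code : ∀ {p x q r} → AllFour p x q r →
              centre (code p x q r) (code q x r p) (code r x p q) ≡ x
centre-code = byCases λ p x q r →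
  centre (code p x q r) (code q x r p) (code r x p q) ≟ x

injective⇒bijective : ∀ {n} {f : Fin n → Fin n} →
                      Injective _≡_ _≡_ f → Bijective _≡_ _≡_ f
injective⇒bijective {zero}      inj = inj , λ ()
injective⇒bijective {suc n} {f} inj = inj , surj
  where
  surj : Surjective _≡_ _≡_ f
  surj y with any? (λ x → f x ≟ y)
  ... | yes (x , fx≡y) = x , λ { refl → fx≡y }
  ... | no  missed     = contradiction
    (injective⇒≤ {f = λ x → punchOut (avoids x)}
      λ {x} {x′} eq → inj (punchOut-injective (avoids x) (avoids x′) eq))
    1+n≰n
    where
    avoids : ∀ x → y ≢ f x
    avoids x y≡fx = missed (x , sym y≡fx)

injective-on-4-cycle : {f : Fin 4 → Color} →
                       (∀ i → f i ≢ f (next i)) → (∀ i → f i ≢ f (next (next i))) →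
                       Injective _≡_ _≡_ f
injective-on-4-cycle {f} near far = inj _ _
  where
  inj : ∀ i j → f i ≡ f j → i ≡ j
  inj 0F 0F _  = refl
  inj 0F 1F eq = contradiction eq (near 0F)
  inj 0F 2F eq = contradiction eq (far 0F)
  inj 0F 3F eq = contradiction (sym eq) (near 3F)
  inj 1F 0F eq = contradiction (sym eq) (near 0F)
  inj 1F 1F _  = refl
  inj 1F 2F eq = contradiction eq (near 1F)
  inj 1F 3F eq = contradiction eq (far 1F)
  inj 2F 0F eq = contradiction eq (far 2F)
  inj 2F 1F eq = contradiction (sym eq) (near 1F)
  inj 2F 2F _  = refl
  inj 2F 3F eq = contradiction eq (near 2F)
  inj 3F 0F eq = contradiction eq (near 3F)
  inj 3F 1F eq = contradiction eq (far 3F)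
  inj 3F 2F eq = contradiction (sym eq) (near 2F)
  inj 3F 3F _  = refl

-- Every element is 0 to 3 steps ahead of any other.
on-4-cycle : (i j : Fin 4) → j ≡ i ⊎ j ≡ next i ⊎ j ≡ next (next i) ⊎ j ≡ next (next (next i))
on-4-cycle 0F 0F = inj₁ refl
on-4-cycle 0F 1F = inj₂ (inj₁ refl)
on-4-cycle 0F 2F = inj₂ (inj₂ (inj₁ refl))
on-4-cycle 0F 3F = inj₂ (inj₂ (inj₂ refl))
on-4-cycle 1F 0F = inj₂ (inj₂ (inj₂ refl))
on-4-cycle 1F 1F = inj₁ refl
on-4-cycle 1F 2F = inj₂ (inj₁ refl)
on-4-cycle 1F 3F = inj₂ (inj₂ (inj₁ refl))
on-4-cycle 2F 0F = inj₂ (inj₂ (inj₁ refl))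
on-4-cycle 2F 1F = inj₂ (inj₂ (inj₂ refl))
on-4-cycle 2F 2F = inj₁ refl
on-4-cycle 2F 3F = inj₂ (inj₁ refl)
on-4-cycle 3F 0F = inj₂ (inj₁ refl)
on-4-cycle 3F 1F = inj₂ (inj₂ (inj₁ refl))
on-4-cycle 3F 2F = inj₂ (inj₂ (inj₂ refl))
on-4-cycle 3F 3F = inj₁ refl

i≢next²i : (i : Fin 4) → i ≢ next (next i)
i≢next²i 0F ()
i≢next²i 1F ()
i≢next²i 2F ()
i≢next²i 3F ()

-- In a total coloring that is bijective on the vertices of a 4-cycle, an edge
-- misses the colors of its ends; its color is that of one of the other two
-- vertices, which are the ends of the opposite edge.
cycle-edges-bijective : ∀ {G} (μ : TotalColoring G) (C : Cycle G 4) → let open TotalColoring μ in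
                        Bijective _≡_ _≡_ (vcol ∘ Cycle.vertex C) →
                        Bijective _≡_ _≡_ (ecol ∘ Cycle.edge C)
cycle-edges-bijective {G} μ C (_ , onto) =
  injective⇒bijective (injective-on-4-cycle near far)
  where
  open Graph G
  open TotalColoring μ
  open Cycle C

  ≢tail : ∀ i → vcol (vertex i) ≢ ecol (edge i)
  ≢tail i = proper-ve (edge i)

  ≢head : ∀ i → vcol (vertex (next i)) ≢ ecol (edge i)
  ≢head i eq = proper-ve (rev (edge i)) (trans eq (sym (ecol-rev (edge i))))

  near : ∀ i → ecol (edge i) ≢ ecol (edge (next i))
  near i eq = proper-ee {rev (edge i)} {edge (next i)} refl
    (λ v≡ → i≢next²i i (distinct v≡)) (trans (ecol-rev (edge i)) eq)

  far : ∀ i → ecol (edge i) ≢ ecol (edge (next (next i)))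
  far i eq with onto (ecol (edge i))
  ... | j , hits with on-4-cycle i j
  ...   | inj₁ refl               = ≢tail i (hits refl)
  ...   | inj₂ (inj₁ refl)        = ≢head i (hits refl)
  ...   | inj₂ (inj₂ (inj₁ refl)) = ≢tail (next (next i)) (trans (hits refl) eq)
  ...   | inj₂ (inj₂ (inj₂ refl)) = ≢head (next (next i)) (trans (hits refl) eq)

-- Periodic words

^^-snoc : ∀ xs k → (xs ^^ k) ++ xs ≡ xs ++ (xs ^^ k)
^^-snoc xs zero    = sym (++-identityʳ xs)
^^-snoc xs (suc k) = trans (++-assoc xs (xs ^^ k) xs) (cong (xs ++_) (^^-snoc xs k))

reverse-^^ : ∀ xs k → reverse (xs ^^ k) ≡ reverse xs ^^ k
reverse-^^ xs zero    = refl
reverse-^^ xs (suc k) = begin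
  reverse (xs ++ (xs ^^ k))          ≡⟨ reverse-++ xs (xs ^^ k) ⟩
  reverse (xs ^^ k) ++ reverse xs    ≡⟨ cong (_++ reverse xs) (reverse-^^ xs k) ⟩
  (reverse xs ^^ k) ++ reverse xs    ≡⟨ ^^-snoc (reverse xs) k ⟩
  reverse xs ++ (reverse xs ^^ k)    ∎
  where open ≡-Reasoning

length-^^₄ : ∀ {a b c d : Color} k → length ((a ∷ b ∷ c ∷ d ∷ []) ^^ k) ≡ k * 4
length-^^₄ zero    = refl
length-^^₄ (suc k) = cong (4 +_) (length-^^₄ k)

concatMap-reverse : ∀ {A B : Set} (g : A → List B) xs →
  concatMap g (reverse xs) ≡ reverse (concatMap (reverse ∘ g) xs)
concatMap-reverse g []       = refl
concatMap-reverse g (x ∷ xs) = begin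
  concatMap g (reverse (x ∷ xs))
    ≡⟨ cong (concatMap g) (unfold-reverse x xs) ⟩
  concatMap g (reverse xs ++ [ x ])
    ≡⟨ concatMap-++ g (reverse xs) [ x ] ⟩
  concatMap g (reverse xs) ++ (g x ++ [])
    ≡⟨ cong₂ _++_ (concatMap-reverse g xs)
                  (trans (++-identityʳ (g x)) (sym (reverse-involutive (g x)))) ⟩
  reverse (concatMap (reverse ∘ g) xs) ++ reverse (reverse (g x))
    ≡⟨ reverse-++ (reverse (g x)) (concatMap (reverse ∘ g) xs) ⟨
  reverse (reverse (g x) ++ concatMap (reverse ∘ g) xs)
    ∎
  where open ≡-Reasoning

-- The letters of a word in odd positions.
odds : List Color → List Color
odds []           = []
odds (x ∷ [])     = [ x ]
odds (x ∷ _ ∷ xs) = x ∷ odds xs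

odds-alternating : ∀ {A : Set} (f g : A → Color) xs →
                   odds (concatMap (λ x → f x ∷ g x ∷ []) xs) ≡ map f xs
odds-alternating f g []       = refl
odds-alternating f g (x ∷ xs) = cong (f x ∷_) (odds-alternating f g xs)

odds-^^₈ : ∀ {a b c d e f g h} k →
  odds ((a ∷ b ∷ c ∷ d ∷ e ∷ f ∷ g ∷ h ∷ []) ^^ k) ≡ (a ∷ c ∷ e ∷ g ∷ []) ^^ k
odds-^^₈                         zero    = refl
odds-^^₈ {a} {c = c} {e = e} {g = g} (suc k) =
  cong (λ xs → a ∷ c ∷ e ∷ g ∷ xs) (odds-^^₈ k)

map-iterate-suc : ∀ {A B : Set} (f : A → B) (s : A → A) x n →
                  map (f ∘ s) (iterate s x n) ≡ map f (iterate s (s x) n)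
map-iterate-suc f s x zero    = refl
map-iterate-suc f s x (suc n) = cong (f (s x) ∷_) (map-iterate-suc f s (s x) n)

-- A closed walk x, s x, s² x, ... whose word of colors is a power of abcd.
module ClosedWalk {A : Set} (s : A → A) (hue : A → Color) (a b c d : Color) where

  s⁴ : A → A
  s⁴ x = fold x s 4

  -- The word abcd starts at x.
  Block : A → Set
  Block x = hue x ≡ a × hue (s x) ≡ b × hue (s (s x)) ≡ c × hue (s (s (s x))) ≡ d

  -- The word of the first 4k elements from x on is the k-th power of abcd.
  Spells : A → ℕ → Set
  Spells x k = map hue (iterate s x (k * 4)) ≡ (a ∷ b ∷ c ∷ d ∷ []) ^^ k

  -- Four colors in a row at y, and the fifth is the first again.
  FourPeriodicAt : A → Set
  FourPeriodicAt y =
    AllFour (hue y) (hue (s y)) (hue (s (s y))) (hue (s (s (s y)))) × hue (s⁴ y) ≡ hue y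

  spells-suc : ∀ {x} k → Spells x (suc k) → Block x × Spells (s⁴ x) k
  spells-suc k eq₀ =
    let eq₁ = ∷-injectiveʳ eq₀ ; eq₂ = ∷-injectiveʳ eq₁ ; eq₃ = ∷-injectiveʳ eq₂
    in (∷-injectiveˡ eq₀ , ∷-injectiveˡ eq₁ , ∷-injectiveˡ eq₂ , ∷-injectiveˡ eq₃)
       , ∷-injectiveʳ eq₃

  fold-shift : ∀ x m n → fold (fold x s m) s n ≡ fold x s (m + n)
  fold-shift x m n = trans (sym (fold-+ x s n)) (cong (fold x s) (+-comm n m))

  module _ {x : A} (k : ℕ) (k≢0 : k ≢ 0)
           (closed : fold x s (k * 4) ≡ x) (spells : Spells x k) where

    -- A power of abcd starts at y and leads back to x.
    Returns : A → Set
    Returns y = ∃[ j ] Spells y j × fold y s (j * 4) ≡ x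

    returns-nonempty : ∀ {y} j → j ≢ 0 → Spells y j → fold y s (j * 4) ≡ x →
                       Block y × Returns (s⁴ y)
    returns-nonempty     zero    j≢0 _  _    = contradiction refl j≢0
    returns-nonempty {y} (suc j) _   sp back =
      let blk , sp′ = spells-suc j sp
      in blk , j , sp′ , trans (fold-shift y 4 (j * 4)) back

    -- With the empty word left, y = x, and the full word starts again.
    returns-step : ∀ {y} → Returns y → Block y × Returns (s⁴ y)
    returns-step (suc j , sp , back) = returns-nonempty (suc j) (λ ()) sp back
    returns-step (zero  , _  , refl) = returns-nonempty k k≢0 spells closed

    returns : ∀ j → Returns (fold x s (j * 4))
    returns zero    = k , spells , closed
    returns (suc j) = proj₂ (returns-step (returns j))

    block : ∀ j → Block (fold x s (j * 4))
    block j = proj₁ (returns-step (returns j))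

    fourPeriodic : AllFour a b c d → ∀ n → FourPeriodicAt (fold x s n)
    fourPeriodic all n = go n 0
      where
      all₁ = allFour-rotate all
      all₂ = allFour-rotate all₁
      all₃ = allFour-rotate all₂

      go : ∀ n j → FourPeriodicAt (fold (fold x s (j * 4)) s n)
      go n j with block j | block (suc j)
      go 0 j | (p , q , r , t) | (p′ , q′ , r′ , t′) =
        allFour-cong p q r t all , trans p′ (sym p)
      go 1 j | (p , q , r , t) | (p′ , q′ , r′ , t′) =
        allFour-cong q r t p′ all₁ , trans q′ (sym q)
      go 2 j | (p , q , r , t) | (p′ , q′ , r′ , t′) =
        allFour-cong r t p′ q′ all₂ , trans r′ (sym r)
      go 3 j | (p , q , r , t) | (p′ , q′ , r′ , t′) =
        allFour-cong t p′ q′ r′ all₃ , trans t′ (sym t)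
      go (suc (suc (suc (suc n)))) j | _ | _ =
        subst FourPeriodicAt (fold-shift (fold x s (j * 4)) 4 n) (go n (suc j))

    -- Any word whose syllables depend on four consecutive colors is periodic too.
    concatMap-periodic : (g : A → List Color) (F : Color → Color → Color → Color → List Color) →
      (∀ y → g y ≡ F (hue y) (hue (s y)) (hue (s (s y))) (hue (s (s (s y))))) →
      concatMap g (iterate s x (k * 4)) ≡
        (F a b c d ++ F b c d a ++ F c d a b ++ F d a b c) ^^ k
    concatMap-periodic g F eq = go k 0
      where
      F-cong : ∀ {a b c d a′ b′ c′ d′} → a ≡ a′ → b ≡ b′ → c ≡ c′ → d ≡ d′ →
               F a b c d ≡ F a′ b′ c′ d′
      F-cong refl refl refl refl = refl

      go : ∀ k j → concatMap g (iterate s (fold x s (j * 4)) (k * 4)) ≡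
                   (F a b c d ++ F b c d a ++ F c d a b ++ F d a b c) ^^ k
      go zero    j = refl
      go (suc k) j with block j | block (suc j) | go k (suc j)
      ... | (p , q , r , t) | (p′ , q′ , r′ , _) | rest = begin
        g y ++ g (s y) ++ g (s (s y)) ++ g (s (s (s y))) ++ R
          ≡⟨ cong₂ _++_ (trans (eq y) (F-cong p q r t))
            (cong₂ _++_ (trans (eq (s y)) (F-cong q r t p′))
            (cong₂ _++_ (trans (eq (s (s y))) (F-cong r t p′ q′))
            (cong₂ _++_ (trans (eq (s (s (s y)))) (F-cong t p′ q′ r′)) rest))) ⟩
        W ++ X ++ Y ++ Z ++ T
          ≡⟨ cong (λ u → W ++ X ++ u) (++-assoc Y Z T) ⟨
        W ++ X ++ (Y ++ Z) ++ T
          ≡⟨ cong (W ++_) (++-assoc X (Y ++ Z) T) ⟨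
        W ++ (X ++ Y ++ Z) ++ T
          ≡⟨ ++-assoc W (X ++ Y ++ Z) T ⟨
        (W ++ X ++ Y ++ Z) ++ T
          ∎
        where
        open ≡-Reasoning
        y = fold x s (j * 4)
        R = concatMap g (iterate s (s⁴ y) (k * 4))
        W = F a b c d
        X = F b c d a
        Y = F c d a b
        Z = F d a b c
        T = (W ++ X ++ Y ++ Z) ^^ k

-- Belts

module _ {G : Graph} (M : Embedding G) where
  open Graph G
  open Embedding M
  open TotalColoring

  face-fold : ∀ e n → face (fold e φ n) ≡ face e
  face-fold e n = sym (Equivalence.from (face-orbit e (fold e φ n)) (n , refl))

  -- The color of the tail of the n-th dart after e on its belt.
  hue : (Vertex → Color) → ℕ → Dart → Color
  hue ν n e = ν (tail (fold e φ n))

  -- On every belt, four consecutive vertices have the four colors, which then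
  -- repeat.
  record FourPeriodic (ν : Vertex → Color) : Set where
    field
      spread : ∀ e → AllFour (hue ν 0 e) (hue ν 1 e) (hue ν 2 e) (hue ν 3 e)
      period : ∀ e → hue ν 4 e ≡ hue ν 0 e

  -- A belt whose vertex colors, read clockwise from e, form a power of abcd.
  module Belt (ν : Vertex → Color) (e : Dart) {a b c d : Color} (all : AllFour a b c d)
              (k : ℕ) (word : map (ν ∘ tail) (clockwise e) ≡ (a ∷ b ∷ c ∷ d ∷ []) ^^ k) where

    faceLength≡ : faceLength (face e) ≡ k * 4
    faceLength≡ = begin
      faceLength (face e)                  ≡⟨ length-iterate φ e _ ⟨
      length (clockwise e)                 ≡⟨ length-map (ν ∘ tail) (clockwise e) ⟨
      length (map (ν ∘ tail) (clockwise e)) ≡⟨ cong length word ⟩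
      length ((a ∷ b ∷ c ∷ d ∷ []) ^^ k)   ≡⟨ length-^^₄ k ⟩
      k * 4                                ∎
      where open ≡-Reasoning

    k≢0 : k ≢ 0
    k≢0 refl = <-irrefl refl (subst (0 <_) faceLength≡ (length-positive (face e)))

    open ClosedWalk φ (ν ∘ tail) a b c d

    closed : fold e φ (k * 4) ≡ e
    closed = subst (λ n → fold e φ n ≡ e) faceLength≡ (length-period e)

    spells : Spells e k
    spells = subst (λ n → map (ν ∘ tail) (iterate φ e n) ≡ _) faceLength≡ word

    belt-fourPeriodic : ∀ n → FourPeriodicAt (fold e φ n)
    belt-fourPeriodic = fourPeriodic k k≢0 closed spells all

    concatMap-clockwise : (g : Dart → List Color) (F : Color → Color → Color → Color → List Color) →
      (∀ y → g y ≡ F (hue ν 0 y) (hue ν 1 y) (hue ν 2 y) (hue ν 3 y)) →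
      concatMap g (clockwise e) ≡ (F a b c d ++ F b c d a ++ F c d a b ++ F d a b c) ^^ k
    concatMap-clockwise g F eq =
      trans (cong (λ n → concatMap g (iterate φ e n)) faceLength≡)
            (concatMap-periodic k k≢0 closed spells g F eq)

  Π⇒fourPeriodic : ∀ {ν} → IsΠColoring M ν → FourPeriodic ν
  Π⇒fourPeriodic {ν} Π = record { spread = proj₁ ∘ onBelt ; period = proj₂ ∘ onBelt }
    where
    onBelt : ∀ e → AllFour (hue ν 0 e) (hue ν 1 e) (hue ν 2 e) (hue ν 3 e) × hue ν 4 e ≡ hue ν 0 e
    onBelt e with IsΠColoring.belts Π (face e)
    ... | e₀ , same , a , b , c , d , all , k , word
      with Equivalence.to (face-orbit e₀ e) same
    ... | n , refl = Belt.belt-fourPeriodic ν e₀ all k word n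

  next-tail : ∀ e → tail (φ e) ≡ head e
  next-tail e = rot-tail (rev e)

  -- The vertex colors of a periodic coloring: the letters in odd positions of
  -- abcadcbd form the word acdb. A counterclockwise reading that ends at the
  -- edge e starts at the tail of e, and lists the heads of the clockwise darts
  -- from last to first; so reversing the word gives the clockwise reading that
  -- starts at φ e.
  periodic⇒Π : ∀ {μ} → IsPeriodicETGC M μ → IsΠColoring M (vcol μ)
  periodic⇒Π {μ} P = record
    { edsPartition = IsETC.edsPartition (IsETGC.isETC isETGC)
    ; belts = belts
    }
    where
    open IsPeriodicETGC P

    vertexWord : ∀ {a b c d : Color} k es →
      alternating M μ es ≡ (a ∷ b ∷ c ∷ a ∷ d ∷ c ∷ b ∷ d ∷ []) ^^ k →
      map (vcol μ ∘ tail) es ≡ (a ∷ c ∷ d ∷ b ∷ []) ^^ k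
    vertexWord k es eq = begin
      map (vcol μ ∘ tail) es     ≡⟨ odds-alternating (vcol μ ∘ tail) (ecol μ) es ⟨
      odds (alternating M μ es)  ≡⟨ cong odds eq ⟩
      odds (_ ^^ k)              ≡⟨ odds-^^₈ k ⟩
      _ ^^ k                     ∎
      where open ≡-Reasoning

    acdb : ∀ {a b c d} → AllFour a b c d → AllFour a c d b
    acdb all k with all k
    ... | here eq                         = here eq
    ... | there (here eq)                 = there (there (there (here eq)))
    ... | there (there (here eq))         = there (here eq)
    ... | there (there (there (here eq))) = there (there (here eq))

    bdca : ∀ {a b c d} → AllFour a b c d → AllFour b d c a
    bdca all k with all k
    ... | here eq                         = there (there (there (here eq)))
    ... | there (here eq)                 = here eq
    ... | there (there (here eq))         = there (there (here eq))
    ... | there (there (there (here eq))) = there (here eq)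

    belts : ∀ f → ∃[ e ] face e ≡ f
          × ∃[ a ] ∃[ b ] ∃[ c ] ∃[ d ] AllFour a b c d
          × ∃[ k ] map (vcol μ ∘ tail) (clockwise e) ≡ (a ∷ b ∷ c ∷ d ∷ []) ^^ k
    belts f with periodic f
    ... | e , on-f , inj₁ (a , b , c , d , all , k , eq) =
      e , on-f , a , c , d , b , acdb all , k , vertexWord k (clockwise e) eq
    ... | e , on-f , inj₂ (a , b , c , d , all , k , eq) =
      φ e , trans (face-fold e 1) on-f , b , d , c , a , bdca all , k , word
      where
      open ≡-Reasoning
      ν = vcol μ
      es = clockwise e
      n = faceLength (face e)
      word : map (ν ∘ tail) (clockwise (φ e)) ≡ (b ∷ d ∷ c ∷ a ∷ []) ^^ k
      word = begin
        map (ν ∘ tail) (clockwise (φ e))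
          ≡⟨ cong (λ f → map (ν ∘ tail) (iterate φ (φ e) (faceLength f))) (face-fold e 1) ⟩
        map (ν ∘ tail) (iterate φ (φ e) n)
          ≡⟨ map-iterate-suc (ν ∘ tail) φ e n ⟨
        map (ν ∘ tail ∘ φ) es
          ≡⟨ map-cong (λ x → cong ν (next-tail x)) es ⟩
        map (ν ∘ head) es
          ≡⟨ reverse-involutive (map (ν ∘ head) es) ⟨
        reverse (reverse (map (ν ∘ head) es))
          ≡⟨ cong reverse (reverse-map (ν ∘ head) es) ⟨
        reverse (map (ν ∘ head) (reverse es))
          ≡⟨ cong reverse (map-∘ (reverse es)) ⟩
        reverse (map (ν ∘ tail) (counterclockwise e))
          ≡⟨ cong reverse (vertexWord k (counterclockwise e) eq) ⟩
        reverse ((a ∷ c ∷ d ∷ b ∷ []) ^^ k)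
          ≡⟨ reverse-^^ (a ∷ c ∷ d ∷ b ∷ []) k ⟩
        (b ∷ d ∷ c ∷ a ∷ []) ^^ k
          ∎

-- Face colorings

  -- The permutation read on the belt of e; it does not depend on the choice of e.
  codeAt : (Vertex → Color) → Dart → Vec Color 3
  codeAt ν e = code (hue ν 0 e) (hue ν 1 e) (hue ν 2 e) (hue ν 3 e)

  codeAt-cong : ∀ {ν ν′} → (∀ v → ν v ≡ ν′ v) → ∀ e → codeAt ν e ≡ codeAt ν′ e
  codeAt-cong eq e = code-cong (eq _) (eq _) (eq _) (eq _)

  codeAt-zero : ∀ ν e → ν (tail e) ≡ 0F →
                codeAt ν e ≡ hue ν 1 e ∷ hue ν 2 e ∷ hue ν 3 e ∷ []
  codeAt-zero ν e eq = code-cong eq refl refl refl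

  module _ {ν : Vertex → Color} (fp : FourPeriodic ν) where
    open FourPeriodic fp

    codeAt-face : ∀ {e e′} → face e ≡ face e′ → codeAt ν e′ ≡ codeAt ν e
    codeAt-face {e} {e′} eq with Equivalence.to (face-orbit e e′) eq
    ... | n , refl = go n
      where
      go : ∀ n → codeAt ν (fold e φ n) ≡ codeAt ν e
      go zero    = refl
      go (suc n) = trans (trans (code-cong refl refl refl (period y)) (code-rotate (spread y))) (go n)
        where y = fold e φ n

    zero-on-belt : ∀ e → ∃[ n ] ν (tail (fold e φ n)) ≡ 0F
    zero-on-belt e with spread e 0F
    ... | here eq                         = 0 , sym eq
    ... | there (here eq)                 = 1 , sym eq
    ... | there (there (here eq))         = 2 , sym eq
    ... | there (there (there (here eq))) = 3 , sym eq

  module _ {μ′ : TotalColoring G} (fp : FourPeriodic (vcol μ′)) {F : FaceColoring M} where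

    reading⇒codeAt : IsAssociated M μ′ F → ∀ e →
                     ThreePermutation.entries (F (face e)) ≡ codeAt (vcol μ′) e
    reading⇒codeAt assoc e with zero-on-belt fp e
    ... | n , is0 = begin
      entries (F (face e))   ≡⟨ cong (entries ∘ F) (face-fold e n) ⟨
      entries (F (face e₀))  ≡⟨ IsAssociated.reading assoc e₀ is0 ⟩
      _                      ≡⟨ codeAt-zero (vcol μ′) e₀ is0 ⟨
      codeAt (vcol μ′) e₀    ≡⟨ codeAt-face fp (sym (face-fold e n)) ⟩
      codeAt (vcol μ′) e     ∎
      where
      open ≡-Reasoning
      open ThreePermutation
      e₀ = fold e φ n

    codeAt⇒associated : IsPeriodicETGC M μ′ →
      (∀ e → ThreePermutation.entries (F (face e)) ≡ codeAt (vcol μ′) e) →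
      IsAssociated M μ′ F
    codeAt⇒associated P eq = record
      { isPeriodicETGC = P
      ; reading = λ e is0 → trans (eq e) (codeAt-zero (vcol μ′) e is0)
      }

  -- Some edge of the belt of f, directed clockwise.
  start : Face → Dart
  start f = proj₁ (face-surjective f)

  face-start : ∀ f → face (start f) ≡ f
  face-start f = proj₂ (face-surjective f) refl

  -- The face coloring given by four-periodic vertex colors.
  faceColoringOf : ∀ {ν} → FourPeriodic ν → FaceColoring M
  faceColoringOf {ν} fp f = record
    { entries       = codeAt ν (start f)
    ; isPermutation = code-↭ (FourPeriodic.spread fp (start f))
    }

-- The star of a vertex

  -- Each closed neighborhood has every color exactly once.
  RainbowNeighborhoods : (Vertex → Color) → Set
  RainbowNeighborhoods ν =
    ∀ v → Bijective (_≡_ on proj₁) _≡_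
                    (λ (u : Σ[ u ∈ Vertex ] u Subset.∈ N[ v ]) → ν (proj₁ u))

  dart-≡ : ∀ {e e′} → tail e ≡ tail e′ → head e ≡ head e′ → e ≡ e′
  dart-≡ {dart u v p} {dart _ _ q} refl refl = cong (dart u v) (T-irrelevant p q)

  rev-rev : ∀ e → rev (rev e) ≡ e
  rev-rev e = dart-≡ refl refl

  φ-rev : ∀ e → φ (rev e) ≡ rot e
  φ-rev e = cong rot (rev-rev e)

  -- A property closed under rotation passes to all darts with the same tail.
  rot-induction : (P : Dart → Set) → (∀ e → P e → P (rot e)) →
                    ∀ {e e′} → tail e ≡ tail e′ → P e → P e′
  rot-induction P step {e} {e′} eq Pe with rot-transitive e e′ eq
  ... | n , refl = go n
    where
    go : ∀ n → P (fold e rot n)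
    go zero    = Pe
    go (suc n) = step _ (go n)

  ~⇒∈N⟨⟩ : ∀ {u v} → v ~ u → u Subset.∈ N⟨ v ⟩
  ~⇒∈N⟨⟩ {u} {v} v~u = lookup⇒[]= u (tabulate (adj v))
    (trans (lookup∘tabulate (adj v) u) (Equivalence.to T-≡ v~u))

  ∈N⟨⟩⇒~ : ∀ {u v} → u Subset.∈ N⟨ v ⟩ → v ~ u
  ∈N⟨⟩⇒~ {u} {v} u∈ =
    Equivalence.from T-≡ (trans (sym (lookup∘tabulate (adj v) u)) ([]=⇒lookup u∈))

  head∈N[] : ∀ {e v} → tail e ≡ v → head e Subset.∈ N[ v ]
  head∈N[] {e} refl = x∈p∪q⁺ (inj₂ (~⇒∈N⟨⟩ (joined e)))

  module Star {ν : Vertex → Color} (fp : FourPeriodic ν) (rainbow : RainbowNeighborhoods ν) where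
    open FourPeriodic fp

    -- The color of the neighbor to which e leads.
    tip : Dart → Color
    tip e = ν (head e)

    tip-injective : ∀ {e e′} → tail e ≡ tail e′ → tip e ≡ tip e′ → e ≡ e′
    tip-injective {e} {e′} t≡ c≡ = dart-≡ t≡
      (proj₁ (rainbow (tail e)) {head e , head∈N[] {e} refl} {head e′ , head∈N[] {e′} (sym t≡)} c≡)

    tip-surjective : ∀ v k → ν v ≢ k → ∃[ e ] tail e ≡ v × tip e ≡ k
    tip-surjective v k νv≢k with proj₂ (rainbow v) k
    ... | (u , u∈) , hits with x∈p∪q⁻ (Subset.⁅ v ⁆) N⟨ v ⟩ u∈
    ...   | inj₁ u∈⁅v⁆ = contradiction
      (trans (cong ν (sym (x∈⁅y⁆⇒x≡y v u∈⁅v⁆))) (hits {u , u∈} refl)) νv≢k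
    ...   | inj₂ u∈N   = dart v u (∈N⟨⟩⇒~ u∈N) , refl , hits {u , u∈} refl

    rot² : Dart → Dart
    rot² e = rot (rot e)

    rot²-tail : ∀ e → tail (rot² e) ≡ tail e
    rot²-tail e = trans (rot-tail (rot e)) (rot-tail e)

    hue₁ : ∀ e → hue ν 1 e ≡ tip e
    hue₁ e = cong ν (next-tail e)

    hue₁-rev : ∀ e → hue ν 1 (rev e) ≡ ν (tail e)
    hue₁-rev e = hue₁ (rev e)

    hue₂-rev : ∀ e → hue ν 2 (rev e) ≡ tip (rot e)
    hue₂-rev e = trans (cong (λ y → ν (tail (φ y))) (φ-rev e)) (hue₁ (rot e))

    -- The belt that enters tail e along rev e and leaves it along rot e.
    corner : ∀ e → AllFour (tip e) (ν (tail e)) (tip (rot e)) (hue ν 3 (rev e))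
    corner e = allFour-cong refl (sym (hue₁-rev e)) (sym (hue₂-rev e)) refl (spread (rev e))

    tip≢tip-rot : ∀ e → tip e ≢ tip (rot e)
    tip≢tip-rot e = 1st≢3rd (corner e)

    tip≢ν : ∀ e → tip e ≢ ν (tail e)
    tip≢ν e = 1st≢2nd (corner e)

    -- If the neighbors along e and rot² e had the same color, rot would
    -- interchange two darts at tail e, and the vertex would have only two
    -- neighbors. But its neighbors show three colors.
    tip≢tip-rot² : ∀ e → tip e ≢ tip (rot² e)
    tip≢tip-rot² e eq =
      let e′ , t≡ , tip≡ = tip-surjective (tail e) (hue ν 3 (rev e)) (1st≢3rd (allFour-rotate (corner e)))
      in absurd tip≡ (rot-induction TwoDarts step {e} {e′} (sym t≡) (inj₁ refl))
      where
      TwoDarts : Dart → Set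
      TwoDarts y = y ≡ e ⊎ y ≡ rot e

      e≡rot²e : e ≡ rot² e
      e≡rot²e = tip-injective {e} {rot² e} (sym (rot²-tail e)) eq

      step : ∀ y → TwoDarts y → TwoDarts (rot y)
      step y (inj₁ y≡) = inj₂ (cong rot y≡)
      step y (inj₂ y≡) = inj₁ (trans (cong rot y≡) (sym e≡rot²e))

      absurd : ∀ {e′} → tip e′ ≡ hue ν 3 (rev e) → ¬ TwoDarts e′
      absurd tip≡ (inj₁ e′≡) = 1st≢4th (corner e) (trans (sym (cong tip e′≡)) tip≡)
      absurd tip≡ (inj₂ e′≡) = 1st≢2nd (allFour-rotate (allFour-rotate (corner e)))
                                       (trans (sym (cong tip e′≡)) tip≡)

    -- The neighbor along rot² e has the one color left, which is also that of the
    -- next vertex on the belt.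
    hue₃-rev : ∀ e → hue ν 3 (rev e) ≡ tip (rot² e)
    hue₃-rev e = sym (fourth (corner e)
      (tip≢tip-rot² e ∘ sym)
      (λ eq → tip≢ν (rot² e) (trans eq (cong ν (sym (rot²-tail e)))))
      (tip≢tip-rot (rot e) ∘ sym))

    -- The colors in the order in which the belt through rev e and rot e has them:
    -- those of the neighbor along e, the vertex, and the other two neighbors.
    star : ∀ e → AllFour (tip e) (ν (tail e)) (tip (rot e)) (tip (rot² e))
    star e = subst (AllFour _ _ _) (hue₃-rev e) (corner e)

    -- Every vertex has degree 3: the only color left for the neighbor along rot³ e
    -- is that of the neighbor along e.
    rot³ : ∀ e → rot (rot² e) ≡ e
    rot³ e = tip-injective {rot (rot² e)} {e} r³-tail (fourth (allFour-rotate (star e))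
      (λ eq → tip≢ν (rot (rot² e)) (trans eq (cong ν (sym r³-tail))))
      (tip≢tip-rot² (rot e) ∘ sym)
      (tip≢tip-rot (rot² e) ∘ sym))
      where
      r³-tail = trans (rot-tail (rot² e)) (rot²-tail e)

-- Edge colors taken from one side

  -- The two belt vertices from which an edge may take its color: the one before
  -- its tail and the one after its head.
  data Side : Set where
    before after : Side

  opposite : Side → Side
  opposite before = after
  opposite after  = before

  -- The color of the chosen belt vertex; by the period 4, the vertex before the
  -- tail has the color found three steps ahead.
  sideHue : (Vertex → Color) → Side → Dart → Color
  sideHue ν before = hue ν 3
  sideHue ν after  = hue ν 2

  sideHue-cong : ∀ {ν ν′} → (∀ v → ν v ≡ ν′ v) → ∀ s e → sideHue ν s e ≡ sideHue ν′ s e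
  sideHue-cong eq before e = eq _
  sideHue-cong eq after  e = eq _

  module Sides {ν : Vertex → Color} (fp : FourPeriodic ν) (rainbow : RainbowNeighborhoods ν) where
    open FourPeriodic fp
    open Star fp rainbow public

    -- The dart at tail e leading to the neighbor whose color is sideHue ν s e.
    turn : Side → Dart → Dart
    turn before = rot²
    turn after  = rot

    turn-tail : ∀ s e → tail (turn s e) ≡ tail e
    turn-tail before = rot²-tail
    turn-tail after  = rot-tail

    turn-injective : ∀ s {e e′} → turn s e ≡ turn s e′ → e ≡ e′
    turn-injective before = rot-injective ∘ rot-injective
    turn-injective after  = rot-injective

    turn-opposite : ∀ s e → turn (opposite s) (turn s e) ≡ e
    turn-opposite before = rot³
    turn-opposite after  = rot³

    -- The dart before e on its belt.
    previous : Dart → Dart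
    previous e = rev (rot² e)

    φ-previous : ∀ e → φ (previous e) ≡ e
    φ-previous e = trans (φ-rev (rot² e)) (rot³ e)

    sideHue-turn : ∀ s e → sideHue ν s e ≡ tip (turn s e)
    sideHue-turn before e =
      trans (cong (hue ν 3) (sym (φ-previous e))) (period (previous e))
    sideHue-turn after e = trans (cong (hue ν 2) (sym (φ-previous e)))
      (trans (hue₃-rev (rot² e)) (cong (tip ∘ rot) (rot³ e)))

    sideHue-rev : ∀ s e → sideHue ν s (rev e) ≡ sideHue ν s e
    sideHue-rev before e = trans (hue₃-rev e) (sym (sideHue-turn before e))
    sideHue-rev after  e = trans (hue₂-rev e) (sym (sideHue-turn after e))

    sideHue≢tail : ∀ s e → ν (tail e) ≢ sideHue ν s e
    sideHue≢tail before e = 1st≢4th (spread e)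
    sideHue≢tail after  e = 1st≢3rd (spread e)

    sideHue≢opposite : ∀ s e → sideHue ν s e ≢ sideHue ν (opposite s) e
    sideHue≢opposite before e = 1st≢2nd (allFour-rotate (allFour-rotate (spread e))) ∘ sym
    sideHue≢opposite after  e = 1st≢2nd (allFour-rotate (allFour-rotate (spread e)))

    -- The total coloring with vertex colors ν whose edges are colored from side s.
    sideColoring : Side → TotalColoring G
    sideColoring s = record
      { vcol      = ν
      ; ecol      = sideHue ν s
      ; ecol-rev  = sideHue-rev s
      ; proper-vv = λ {u} {v} u~v → tip≢ν (dart u v u~v) ∘ sym
      ; proper-ve = sideHue≢tail s
      ; proper-ee = λ {e} {e′} t≡ h≢ c≡ → h≢ (cong head (turn-injective s {e} {e′}
          (tip-injective {turn s e} {turn s e′}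
            (trans (turn-tail s e) (trans t≡ (sym (turn-tail s e′))))
            (trans (sym (sideHue-turn s e)) (trans c≡ (sideHue-turn s e′))))))
      }

  -- A total coloring whose vertex colors are four-periodic and have rainbow
  -- neighborhoods.
  module _ (μ : TotalColoring G)
           (fp : FourPeriodic (vcol μ)) (rainbow : RainbowNeighborhoods (vcol μ)) where
    open FourPeriodic fp
    open Sides fp rainbow

    private ν = vcol μ

    -- e has its color from side s.
    TakenFrom : Side → Dart → Set
    TakenFrom s e = ecol μ e ≡ sideHue ν s e

    taken : ∀ s e → TakenFrom s e ⊎ TakenFrom (opposite s) e
    taken s e with third-or-fourth (spread e) (proper-ve μ e ∘ sym) ≢head
      where
      ≢head : ecol μ e ≢ hue ν 1 e
      ≢head eq = proper-ve μ (rev e) (trans (sym (hue₁ e)) (trans (sym eq) (sym (ecol-rev μ e))))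
    taken before e | inj₁ eq = inj₂ eq
    taken before e | inj₂ eq = inj₁ eq
    taken after  e | inj₁ eq = inj₁ eq
    taken after  e | inj₂ eq = inj₂ eq

    -- The color of e excludes the opposite side for e′.
    taken-step : ∀ s {e e′} → tail e ≡ tail e′ → tip e ≢ tip e′ →
                 turn (opposite s) e′ ≡ turn s e → TakenFrom s e → TakenFrom s e′
    taken-step s {e} {e′} t≡ tip≢ turn≡ eq with taken s e′
    ... | inj₁ eq′ = eq′
    ... | inj₂ eq′ = contradiction same (proper-ee μ t≡ (tip≢ ∘ cong ν))
      where
      open ≡-Reasoning
      same : ecol μ e ≡ ecol μ e′
      same = begin
        ecol μ e                    ≡⟨ eq ⟩
        sideHue ν s e               ≡⟨ sideHue-turn s e ⟩
        tip (turn s e)              ≡⟨ cong tip turn≡ ⟨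
        tip (turn (opposite s) e′)  ≡⟨ sideHue-turn (opposite s) e′ ⟨
        sideHue ν (opposite s) e′   ≡⟨ eq′ ⟨
        ecol μ e′                   ∎

    -- Hence all edges at a vertex take their colors from the same side.
    taken-rot : ∀ s e → TakenFrom s e → TakenFrom s (rot e)
    taken-rot before e = taken-step before (sym (rot-tail e)) (tip≢tip-rot e) refl
    taken-rot after  e =
      subst (TakenFrom after) (cong rot (rot³ e)) ∘ twice (rot² e) ∘ twice e
      where
      twice : ∀ e → TakenFrom after e → TakenFrom after (rot² e)
      twice e = taken-step after (sym (rot²-tail e)) (tip≢tip-rot² e) (cong rot (rot³ e))

    module _ (s : Side) (zero-side : ∀ e → ecol μ e ≡ 0F → sideHue ν s e ≡ 0F) where

      not-opposite : ∀ e → ν (tail e) ≢ 0F → ¬ TakenFrom (opposite s) e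
      not-opposite e ν≢0 eq =
        let e₀ , t≡ , tip≡0 = tip-surjective (tail e) 0F ν≢0 in at e₀ t≡ tip≡0
        where
        -- If all edges at tail e take their colors from the opposite side, then
        -- y is the one colored 0 by the neighbor along e₀.
        at : ∀ e₀ → tail e₀ ≡ tail e → tip e₀ ≢ 0F
        at e₀ t≡ tip≡0 = sideHue≢opposite s y (trans (zero-side y (trans eq-y opp≡0)) (sym opp≡0))
          where
          y = turn s e₀
          eq-y : TakenFrom (opposite s) y
          eq-y = rot-induction (TakenFrom (opposite s)) (taken-rot (opposite s)) {e} {y}
                   (sym (trans (turn-tail s e₀) t≡)) eq
          opp≡0 : sideHue ν (opposite s) y ≡ 0F
          opp≡0 = trans (sideHue-turn (opposite s) y)
                        (trans (cong tip (turn-opposite s e₀)) tip≡0)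

      taken-everywhere : ∀ e → TakenFrom s e
      taken-everywhere e with taken s e | ν (tail e) ≟ 0F
      ... | inj₁ eq | _      = eq
      ... | inj₂ eq | no ν≢0 = contradiction eq (not-opposite e ν≢0)
      ... | inj₂ eq | yes ν≡0 = contradiction
        (trans (ecol-rev μ e) (trans eq (sym (sideHue-rev (opposite s) e))))
        (not-opposite (rev e) (λ tip≡0 → tip≢ν e (trans tip≡0 (sym ν≡0))))

-- The two correspondences

  etgc-rainbow : ∀ {μ} → IsETGC G μ → RainbowNeighborhoods (vcol μ)
  etgc-rainbow = IsETC.closedNbhd-bijective ∘ IsETGC.isETC

  -- An ETGC of the Π-map whose edges all take their colors from side s. The
  -- DETGCs are those with s = before, the RETGCs those with s = after.
  record SidedETGC (s : Side) (μ : TotalColoring G) : Set where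
    field
      isETGCOfΠMap : IsETGCOfΠMap M μ
      sided        : ∀ e → ecol μ e ≡ sideHue (vcol μ) s e

    open IsETGCOfΠMap isETGCOfΠMap public

    fourPeriodicColors : FourPeriodic (vcol μ)
    fourPeriodicColors = Π⇒fourPeriodic isΠColoring

    rainbowNbhds : RainbowNeighborhoods (vcol μ)
    rainbowNbhds = etgc-rainbow isETGC

  directed⇒sided : ∀ {μ} → IsETGCOfΠMap M μ → (∀ f → Directed M μ f) → SidedETGC before μ
  directed⇒sided {μ} etgc dir = record
    { isETGCOfΠMap = etgc
    ; sided = taken-everywhere μ fp (etgc-rainbow isETGC) before zero-side
    }
    where
    open IsETGCOfΠMap etgc
    fp = Π⇒fourPeriodic isΠColoring
    zero-side : ∀ e → ecol μ e ≡ 0F → hue (vcol μ) 3 e ≡ 0F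
    zero-side e e≡0 with dir (face e) e refl e≡0
    ... | e₀ , v≡0 , refl = trans (FourPeriodic.period fp e₀) v≡0

  sided⇒directed : ∀ {μ} → SidedETGC before μ → ∀ f → Directed M μ f
  sided⇒directed {μ} S f e _ e≡0 =
    previous e , trans (sym (sideHue-turn before e)) (trans (sym (sided e)) e≡0) , φ-previous e
    where
    open SidedETGC S
    open Sides fourPeriodicColors rainbowNbhds

  hue₂-next : ∀ (ν : Vertex → Color) e → hue ν 2 e ≡ ν (head (φ e))
  hue₂-next ν e = cong ν (next-tail (φ e))

  reversed⇒sided : ∀ {μ} → IsETGCOfΠMap M μ → (∀ f → Reversed M μ f) → SidedETGC after μ
  reversed⇒sided {μ} etgc rvd = record
    { isETGCOfΠMap = etgc
    ; sided = taken-everywhere μ (Π⇒fourPeriodic isΠColoring) (etgc-rainbow isETGC) after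
        λ e e≡0 → trans (hue₂-next (vcol μ) e) (rvd (face e) e refl e≡0)
    }
    where open IsETGCOfΠMap etgc

  sided⇒reversed : ∀ {μ} → SidedETGC after μ → ∀ f → Reversed M μ f
  sided⇒reversed {μ} S f e _ e≡0 =
    trans (sym (hue₂-next (vcol μ) e)) (trans (sym (SidedETGC.sided S e)) e≡0)

  -- On a belt with vertex colors abcd, read clockwise, the edges have the colors
  -- dabc from the side before and cdab from the side after. So the belt spells
  -- adbacbdc clockwise in the first case, and abdacdbc counterclockwise in the
  -- second.
  sided⇒periodic : ∀ {s μ} → SidedETGC s μ → IsPeriodicETGC M μ
  sided⇒periodic {s} {μ} S = record { isETGC = isETGC ; periodic = periodic s sided }
    where
    open SidedETGC S using (isETGC; isΠColoring; sided)
    ν = vcol μ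

    adbc : ∀ {a b c d} → AllFour a b c d → AllFour a d b c
    adbc all k with all k
    ... | here eq                         = here eq
    ... | there (here eq)                 = there (there (here eq))
    ... | there (there (here eq))         = there (there (there (here eq)))
    ... | there (there (there (here eq))) = there (here eq)

    abdc : ∀ {a b c d} → AllFour a b c d → AllFour a b d c
    abdc all k with all k
    ... | here eq                         = here eq
    ... | there (here eq)                 = there (here eq)
    ... | there (there (here eq))         = there (there (there (here eq)))
    ... | there (there (there (here eq))) = there (there (here eq))

    periodic : ∀ s → (∀ e → ecol μ e ≡ sideHue ν s e) → ∀ f → ∃[ e ] face e ≡ f
             × (IsPeriodicSequence M (alternating M μ (clockwise e))
               ⊎ IsPeriodicSequence M (alternating M μ (counterclockwise e)))
    periodic s sided f with IsΠColoring.belts isΠColoring f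
    periodic before sided f | e , on-f , a , b , c , d , all , k , word =
      e , on-f , inj₁ (a , d , b , c , adbc all , k ,
        concatMap-clockwise (λ x → ν (tail x) ∷ ecol μ x ∷ []) (λ a _ _ d → a ∷ d ∷ [])
          (λ x → cong (λ k → ν (tail x) ∷ k ∷ []) (sided x)))
      where open Belt ν e all k word
    periodic after sided f | e , on-f , a , b , c , d , all , k , word =
      e , on-f , inj₂ (a , b , d , c , abdc all , k , (begin
        concatMap g (map rev (reverse es))
          ≡⟨ concatMap-map g rev (reverse es) ⟩
        concatMap (g ∘ rev) (reverse es)
          ≡⟨ concatMap-reverse (g ∘ rev) es ⟩
        reverse (concatMap (reverse ∘ g ∘ rev) es)
          ≡⟨ cong reverse (concatMap-clockwise (reverse ∘ g ∘ rev) (λ _ b c _ → c ∷ b ∷ [])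
               λ x → cong₂ (λ k l → k ∷ l ∷ []) (trans (ecol-rev μ x) (sided x))
                           (cong ν (sym (next-tail x)))) ⟩
        reverse ((c ∷ b ∷ d ∷ c ∷ a ∷ d ∷ b ∷ a ∷ []) ^^ k)
          ≡⟨ reverse-^^ (c ∷ b ∷ d ∷ c ∷ a ∷ d ∷ b ∷ a ∷ []) k ⟩
        (a ∷ b ∷ d ∷ a ∷ c ∷ d ∷ b ∷ c ∷ []) ^^ k
          ∎))
      where
      open ≡-Reasoning
      open Belt ν e all k word
      es = clockwise e
      g : Dart → List Color
      g x = ν (tail x) ∷ ecol μ x ∷ []

  -- From either side, the edges of a periodic ETGC can be recolored to give a
  -- sided ETGC with the same vertex colors.
  recolor : ∀ s {μ} → IsPeriodicETGC M μ →
            Σ[ μ* ∈ TotalColoring G ] SidedETGC s μ* × (∀ v → vcol μ* v ≡ vcol μ v)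
  recolor s {μ} P = μ* , sidedETGC , λ _ → refl
    where
    open IsPeriodicETGC P using (isETGC)
    open IsETGC isETGC
    Π = periodic⇒Π P
    μ* = Sides.sideColoring (Π⇒fourPeriodic Π) (etgc-rainbow isETGC) s

    sidedETGC : SidedETGC s μ*
    sidedETGC = record
      { isETGCOfΠMap = record
        { isETGC = record
          { isETC = record
            { closedNbhd-bijective = IsETC.closedNbhd-bijective isETC
            ; edsPartition         = IsETC.edsPartition isETC
            }
          ; cycle-vertices = cycle-vertices
          ; cycle-edges    = λ C → cycle-edges-bijective μ* C (cycle-vertices C)
          }
        ; isΠColoring = Π
        }
      ; sided = λ _ → refl
      }

  module _ {ν : Vertex → Color} (fp : FourPeriodic ν) (rainbow : RainbowNeighborhoods ν) where
    open Star fp rainbow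

    -- The three faces at a vertex determine its color.
    centre-codeAt : ∀ e → centre (codeAt ν (rev e)) (codeAt ν (rev (rot e))) (codeAt ν (rev (rot² e)))
                          ≡ ν (tail e)
    centre-codeAt e = begin
      centre (codeAt ν (rev e)) (codeAt ν (rev (rot e))) (codeAt ν (rev (rot² e)))
        ≡⟨ cong₂ (λ A (B , C) → centre A B C) (codeAt-rev e refl refl refl refl)
             (cong₂ _,_
               (codeAt-rev (rot e) refl (rot-tail e) refl (rot³ e))
               (codeAt-rev (rot² e) refl (rot²-tail e) (rot³ e) (cong rot (rot³ e)))) ⟩
      centre (code p x q r) (code q x r p) (code r x p q)
        ≡⟨ centre-code (star e) ⟩
      x ∎
      where
      open ≡-Reasoning
      x = ν (tail e)
      p = tip e
      q = tip (rot e)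
      r = tip (rot² e)
      codeAt-rev : ∀ y {p v q r} → y ≡ p → tail y ≡ v → rot y ≡ q → rot² y ≡ r →
                   codeAt ν (rev y) ≡ code (tip p) (ν v) (tip q) (tip r)
      codeAt-rev y refl refl refl refl =
        code-cong refl (hue₁-rev y) (hue₂-rev y) (hue₃-rev y)

    -- The vertex has neighbors, since they show the three other colors.
    dart-at : ∀ v → ∃[ e ] tail e ≡ v
    dart-at v with ν v ≟ 0F
    ... | no ν≢0  = let e , t≡ , _ = tip-surjective v 0F ν≢0 in e , t≡
    ... | yes ν≡0 =
      let e , t≡ , _ = tip-surjective v 1F (λ ν≡1 → contradiction (trans (sym ν≡0) ν≡1) λ ()) in e , t≡

  -- Colorings with the same face codes have the same vertex colors.
  codeAt-injective : ∀ {ν ν′} → FourPeriodic ν → RainbowNeighborhoods ν →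
    FourPeriodic ν′ → RainbowNeighborhoods ν′ →
    (∀ f → codeAt ν (start f) ≡ codeAt ν′ (start f)) → ∀ v → ν v ≡ ν′ v
  codeAt-injective {ν} {ν′} fp rb fp′ rb′ same v with dart-at fp rb v
  ... | e , refl = begin
    ν (tail e)
      ≡⟨ centre-codeAt fp rb e ⟨
    centre (codeAt ν (rev e)) (codeAt ν (rev (rot e))) (codeAt ν (rev (rot (rot e))))
      ≡⟨ cong₂ (λ A (B , C) → centre A B C) (same′ (rev e))
           (cong₂ _,_ (same′ (rev (rot e))) (same′ (rev (rot (rot e))))) ⟩
    centre (codeAt ν′ (rev e)) (codeAt ν′ (rev (rot e))) (codeAt ν′ (rev (rot (rot e))))
      ≡⟨ centre-codeAt fp′ rb′ e ⟩
    ν′ (tail e)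
      ∎
    where
    open ≡-Reasoning
    same′ : ∀ e → codeAt ν e ≡ codeAt ν′ e
    same′ e = trans (codeAt-face fp (face-start (face e)))
              (trans (same (face e)) (sym (codeAt-face fp′ (face-start (face e)))))

  sided-associated : ∀ {s μ} (S : SidedETGC s μ) →
                     IsAssociated M μ (faceColoringOf (SidedETGC.fourPeriodicColors S))
  sided-associated S = codeAt⇒associated fourPeriodicColors (sided⇒periodic S)
    λ e → codeAt-face fourPeriodicColors (sym (face-start (face e)))
    where open SidedETGC S

  -- Here A stands for the type of DETGCs or of RETGCs; the last argument says that
  -- every sided ETGC is among them.
  sidedBijection : ∀ s {A : Set} (coloring : A → TotalColoring G) →
    (S : ∀ x → SidedETGC s (coloring x)) →
    (∀ {μ} → SidedETGC s μ → ∃[ x ] coloring x ≡ μ) →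
    Σ[ β ∈ Bijection (On.setoid (totalColorings M) coloring) (PFCs M) ]
      (∀ x → IsAssociated M (coloring x) (PFC.faceColoring (Bijection.to β x)))
  sidedBijection s {A} coloring S present = β , λ x → sided-associated (S x)
    where
    ν : A → Vertex → Color
    ν = vcol ∘ coloring

    toPFC : A → PFC M
    toPFC x = record
      { faceColoring = faceColoringOf (SidedETGC.fourPeriodicColors (S x))
      ; fromPeriodic = coloring x , sided-associated (S x)
      }

    module _ {x y : A} (same : ∀ f → codeAt (ν x) (start f) ≡ codeAt (ν y) (start f)) where
      module X = SidedETGC (S x)
      module Y = SidedETGC (S y)

      same-vcol : ∀ v → ν x v ≡ ν y v
      same-vcol = codeAt-injective X.fourPeriodicColors X.rainbowNbhds
                                   Y.fourPeriodicColors Y.rainbowNbhds same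

      same-ecol : ∀ e → ecol (coloring x) e ≡ ecol (coloring y) e
      same-ecol e = trans (X.sided e) (trans (sideHue-cong same-vcol s e) (sym (Y.sided e)))

    surjective : ∀ (F : PFC M) → ∃[ x ] (∀ {z} →
      Setoid._≈_ (On.setoid (totalColorings M) coloring) z x → Setoid._≈_ (PFCs M) (toPFC z) F)
    surjective record { faceColoring = F ; fromPeriodic = μ′ , assoc }
      with recolor s (IsAssociated.isPeriodicETGC assoc)
    ... | μ* , S* , same with present S*
    ...   | x , refl = x , λ {z} (z≡x , _) f → begin
      codeAt (ν z) (start f)        ≡⟨ codeAt-cong z≡x (start f) ⟩
      codeAt (ν x) (start f)        ≡⟨ codeAt-cong same (start f) ⟩
      codeAt (vcol μ′) (start f)    ≡⟨ reading⇒codeAt fp′ assoc (start f) ⟨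
      entries (F (face (start f)))  ≡⟨ cong (entries ∘ F) (face-start f) ⟩
      entries (F f)                 ∎
      where
      open ≡-Reasoning
      open ThreePermutation
      fp′ = Π⇒fourPeriodic (periodic⇒Π (IsAssociated.isPeriodicETGC assoc))

    β : Bijection (On.setoid (totalColorings M) coloring) (PFCs M)
    β = record
      { to        = toPFC
      ; cong      = λ (v≡ , _) f → codeAt-cong v≡ (start f)
      ; bijective = (λ {x} {y} same → same-vcol {x} {y} same , same-ecol {x} {y} same)
                  , surjective
      }

theorem33 : (G : Graph) → Connected G → Cubic G → HasGirth G 4 →
    (M : Embedding G) → IsΠMap M →
    (Σ[ β ∈ Bijection (DETGCs M) (PFCs M) ]
    (∀ μ′ → IsAssociated M (DETGC.coloring μ′) (PFC.faceColoring (Bijection.to β μ′))))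
    × (Σ[ β ∈ Bijection (RETGCs M) (PFCs M) ]
    (∀ μ′ → IsAssociated M (RETGC.coloring μ′) (PFC.faceColoring (Bijection.to β μ′))))
theorem33 G _ _ _ M _ =
    sidedBijection M before DETGC.coloring
      (λ x → directed⇒sided M (DETGC.isETGCOfΠMap x) (DETGC.directed x))
      (λ S → record { isETGCOfΠMap = SidedETGC.isETGCOfΠMap S ; directed = sided⇒directed M S } , refl)
  , sidedBijection M after RETGC.coloring
      (λ x → reversed⇒sided M (RETGC.isETGCOfΠMap x) (RETGC.reversed x))
      (λ S → record { isETGCOfΠMap = SidedETGC.isETGCOfΠMap S ; reversed = sided⇒reversed M S } , refl)
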